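{- Let $k\ge2$, $m\ge0$, $1\le s\le k$, and $N=mk+s$. The numbers of permutations in $\mathcal{D}_{N,k}$ avoiding the fully consecutive patterns of length three are as follows. (1) $|\mathcal{D}_{N,k}(\underline{123})|=0$ if $k\ge3$ and $N\ge3$; and $\mathcal{D}_{N,k}(\underline{123})=\mathcal{D}_{N,k}$ if $N<3$ or $k=2$. (2) $|\mathcal{D}_{N,k}(\underline{321})|=|\mathcal{D}_{N,k}|$. (3) $|\mathcal{D}_{N,k}(\underline{312})|=k^m\,m!$. (4) $|\mathcal{D}_{N,k}(\underline{231})|=\prod_{j=0}^{m-1}(s+jk)$. (5) $|\mathcal{D}_{N,k}(\underline{132})|=\operatorname{LE}(P^{132}_{m,s,k})$, where $P^{132}_{m,s,k}$ is the poset obtained from the block poset $B_{m,s,k}$ by adding the relations $x_{i+1,1}<x_{i,k-1}$ for $1\le i\le m$, whenever $x_{i,k-1}$ exists. (6) $|\mathcal{D}_{N,k}(\underline{213})|=\operatorname{LE}(P^{213}_{m,s,k})$, where $P^{213}_{m,s,k}$ is the poset obtained from $B_{m,s,k}$ by adding the relations $x_{i+1,2}<x_{i,k}$ for $1\le i\le m$, whenever $x_{i+1,2}$ exists.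
   Context: For $\pi=\pi_1\cdots\pi_N\in S_N$ let $\operatorname{Des}(\pi)=\{i\in[N-1]:\pi_i>\pi_{i+1}\}$. For $k\ge2$, $N\ge1$, let $\mathcal{D}_{N,k}=\{\pi\in S_N:\operatorname{Des}(\pi)=\{k,2k,\ldots,k\lfloor (N-1)/k\rfloor\}\}$. For $p\in S_3$, $\underline{p}$ denotes the fully consecutive pattern: $\pi$ contains $\underline{p}$ if some three entries in consecutive positions $\pi_i\pi_{i+1}\pi_{i+2}$ have the same relative order as $p$, and otherwise avoids it; $\mathcal{D}_{N,k}(\underline{p})$ is the set of elements of $\mathcal{D}_{N,k}$ avoiding $\underline{p}$. Empty products equal $1$. Write $N=mk+s$ with $1\le s\le k$, and split the positions $1,\ldots,N$ from left to right into $m$ blocks of length $k$ followed by a last block of length $s$; $x_{i,a}$ is the $a$-th position of the $i$-th block ($1\le a\le k$ for $i\le m$, $1\le a\le s$ for $i=m+1$). The block poset $B_{m,s,k}$ on the elements $x_{i,a}$ is generated by $x_{i,a}<x_{i,a+1}$ inside each block and $x_{i+1,1}<x_{i,k}$ for $1\le i\le m$. "Adding relations" to a poset means taking the transitive closure. $\operatorname{LE}(P)$ is the number of linear extensions of a finite poset $P$. -}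

module Defs where

open import Data.Fin using (Fin; toℕ)
open import Data.Fin.Patterns using (0F; 1F; 2F)
open import Data.Fin.Permutation using (Permutation′; _⟨$⟩ʳ_; _≈_; permutation)
open import Data.Fin.Properties using (all?; _≟_)
import Data.Fin as Fin
open import Data.Nat using (ℕ; zero; suc; NonZero; _+_; _*_; _∸_; _≤_; _<_)
open import Data.Nat.DivMod using (_/_; _%_; [m+kn]%n≡m%n; m<n⇒m%n≡m; +-distrib-/-∣ʳ; m<n⇒m/n≡0; m*n/n≡m)
open import Data.Nat.Divisibility using (n∣m*n)
open import Data.Nat.Properties hiding (_≟_)
open import Data.Product using (Σ; ∃; ∃₂; _×_; _,_; proj₁)
open import Data.Sum using (inj₁; inj₂)
open import Data.Vec using (Vec; lookup; []; _∷_)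
open import Function using (_⇔_; Inverse)
open import Level using (0ℓ)
open import Relation.Binary using (Rel; Setoid; IsStrictPartialOrder; _=[_]⇒_)
open import Relation.Binary.Construct.Closure.Transitive using (TransClosure; [_]; _∷_; transitive)
import Relation.Binary.Construct.On as On
open import Relation.Binary.Construct.Union using (_∪_)
open import Relation.Binary.PropositionalEquality
open import Relation.Nullary using (¬_)
open import Relation.Nullary.Decidable using (True; toWitness)
open import Relation.Unary using (Pred; _∩_; _≐_)

-- Permutations are compared by their values, as proof data is not part of a
-- permutation's identity.

Permutationₛ : ℕ → Setoid 0ℓ 0ℓ
Permutationₛ N = record
  { Carrier       = Permutation′ N
  ; _≈_           = _≈_
  ; isEquivalence = record
    { refl  = λ _ → refl
    ; sym   = λ eq i → sym (eq i)
    ; trans = λ eq₁ eq₂ i → trans (eq₁ i) (eq₂ i)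
    }
  }

⟦_⟧ : ∀ {N} → Pred (Permutation′ N) 0ℓ → Setoid 0ℓ 0ℓ
⟦_⟧ {N} P = On.setoid {B = Σ (Permutation′ N) P} (Permutationₛ N) proj₁

infix 4 _HasSize_ _≃#_

_HasSize_ : Setoid 0ℓ 0ℓ → ℕ → Set
S HasSize n = Inverse S (setoid (Fin n))

_≃#_ : Setoid 0ℓ 0ℓ → Setoid 0ℓ 0ℓ → Set
S ≃# T = ∃ λ n → S HasSize n × T HasSize n

-- Positions and values of a permutation are 0-based (elements of Fin N), while
-- descents are 1-based: d is a descent when π_d > π_{d+1}, i.e. when the values
-- at the 0-based positions d - 1 and d decrease.

Des : ∀ {N} → Permutation′ N → Pred ℕ 0ℓ
Des {N} π d = ∃₂ λ (i j : Fin N) →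
  suc (toℕ i) ≡ d × toℕ j ≡ d × π ⟨$⟩ʳ j Fin.< π ⟨$⟩ʳ i

-- {k, 2k, …, k ⌊(N-1)/k⌋}
Multiples : (N k : ℕ) .{{_ : NonZero k}} → Pred ℕ 0ℓ
Multiples N k d = ∃ λ q → 1 ≤ q × q ≤ (N ∸ 1) / k × d ≡ q * k

𝒟 : (N k : ℕ) .{{_ : NonZero k}} → Pred (Permutation′ N) 0ℓ
𝒟 N k π = Des π ≐ Multiples N k

Contains : ∀ {N} → Permutation′ N → Permutation′ 3 → Set
Contains {N} π p = ∃₂ λ (i : ℕ) (pos : Fin 3 → Fin N) →
  (∀ u → toℕ (pos u) ≡ i + toℕ u) ×
  (∀ u v → (p ⟨$⟩ʳ u Fin.< p ⟨$⟩ʳ v) ⇔ (π ⟨$⟩ʳ pos u Fin.< π ⟨$⟩ʳ pos v))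

Avoids : ∀ {N} → Permutation′ 3 → Pred (Permutation′ N) 0ℓ
Avoids p π = ¬ Contains π p

𝒟[_] : Permutation′ 3 → (N k : ℕ) .{{_ : NonZero k}} → Pred (Permutation′ N) 0ℓ
𝒟[ p ] N k = 𝒟 N k ∩ Avoids p

-- One-line notation (0-based) of a permutation and of its inverse.
oneLine : ∀ {n} (v w : Vec (Fin n) n)
  {_ : True (all? λ i → lookup v (lookup w i) ≟ i)}
  {_ : True (all? λ i → lookup w (lookup v i) ≟ i)} → Permutation′ n
oneLine v w {vw} {wv} = permutation (lookup v) (lookup w) (toWitness vw) (toWitness wv)

p123 p132 p213 p231 p312 p321 : Permutation′ 3
p123 = oneLine (0F ∷ 1F ∷ 2F ∷ []) (0F ∷ 1F ∷ 2F ∷ [])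
p132 = oneLine (0F ∷ 2F ∷ 1F ∷ []) (0F ∷ 2F ∷ 1F ∷ [])
p213 = oneLine (1F ∷ 0F ∷ 2F ∷ []) (1F ∷ 0F ∷ 2F ∷ [])
p231 = oneLine (1F ∷ 2F ∷ 0F ∷ []) (2F ∷ 0F ∷ 1F ∷ [])
p312 = oneLine (2F ∷ 0F ∷ 1F ∷ []) (1F ∷ 2F ∷ 0F ∷ [])
p321 = oneLine (2F ∷ 1F ∷ 0F ∷ []) (2F ∷ 1F ∷ 0F ∷ [])

record FinitePoset (n : ℕ) : Set₁ where
  field
    _≺_                  : Rel (Fin n) 0ℓ
    isStrictPartialOrder : IsStrictPartialOrder _≡_ _≺_

-- A linear extension sends each element to its place in the linear order.
LinearExtension : ∀ {n} → FinitePoset n → Pred (Permutation′ n) 0ℓ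
LinearExtension P σ = _≺_ =[ σ ⟨$⟩ʳ_ ]⇒ Fin._<_
  where open FinitePoset P

LinearExtensions : ∀ {n} → FinitePoset n → Setoid 0ℓ 0ℓ
LinearExtensions P = ⟦ LinearExtension P ⟧

-- The rank function only serves to show that the generators are acyclic.
module _ {n : ℕ} (_~_ : Rel (Fin n) 0ℓ) (rank : Fin n → ℕ)
         (mono : _~_ =[ rank ]⇒ _<_) where

  closure-mono : TransClosure _~_ =[ rank ]⇒ _<_
  closure-mono [ r ]    = mono r
  closure-mono (r ∷ rs) = <-trans (mono r) (closure-mono rs)

  generatedBy : FinitePoset n
  generatedBy = record
    { _≺_                  = TransClosure _~_
    ; isStrictPartialOrder = record
      { isEquivalence = isEquivalence
      ; irrefl        = λ { refl rs → <-irrefl refl (closure-mono rs) }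
      ; trans         = transitive _~_
      ; <-resp-≈      = (λ { refl r → r }) , (λ { refl r → r })
      }
    }

module Blocks (m s k : ℕ) .{{_ : NonZero k}} where

  N : ℕ
  N = m * k + s

  -- x i a p says that p is the a-th position of the i-th block, with i and a
  -- 1-based as in x_{i,a}.  When 1 ≤ s ≤ k, the bounds i ≤ m + 1, and a ≤ s in
  -- block m + 1, follow from p being one of the N positions.
  record x (i a : ℕ) (p : Fin N) : Set where
    constructor at
    field
      1≤i      : 1 ≤ i
      1≤a      : 1 ≤ a
      a≤k      : a ≤ k
      position : toℕ p ≡ (i ∸ 1) * k + (a ∸ 1)

  data Block : Rel (Fin N) 0ℓ where
    within  : ∀ {i a p q} → x i a p → x i (suc a) q → Block p q
    between : ∀ {i p q} → i ≤ m → x (suc i) 1 p → x i k q → Block p q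

  data Extra132 : Rel (Fin N) 0ℓ where
    extra : ∀ {i p q} → i ≤ m → x (suc i) 1 p → x i (k ∸ 1) q → Extra132 p q

  data Extra213 : Rel (Fin N) 0ℓ where
    extra : ∀ {i p q} → i ≤ m → x (suc i) 2 p → x i k q → Extra213 p q

  rank : Fin N → ℕ
  rank p = (m ∸ toℕ p / k) * k + toℕ p % k

  rank-x : ∀ {i a p} → x i a p → rank p ≡ (m ∸ (i ∸ 1)) * k + (a ∸ 1)
  rank-x {suc i} {suc a} {p} (at _ _ a<k eq) =
    cong₂ (λ b c → (m ∸ b) * k + c) quotient remainder
    where
    open ≡-Reasoning
    eq′ : toℕ p ≡ a + i * k
    eq′ = trans eq (+-comm (i * k) a)
    quotient : toℕ p / k ≡ i
    quotient = begin
      toℕ p / k           ≡⟨ cong (_/ k) eq′ ⟩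
      (a + i * k) / k     ≡⟨ +-distrib-/-∣ʳ a (n∣m*n i) ⟩
      a / k + i * k / k   ≡⟨ cong₂ _+_ (m<n⇒m/n≡0 a<k) (m*n/n≡m i k) ⟩
      i                   ∎
    remainder : toℕ p % k ≡ a
    remainder = begin
      toℕ p % k           ≡⟨ cong (_% k) eq′ ⟩
      (a + i * k) % k     ≡⟨ [m+kn]%n≡m%n a i k ⟩
      a % k               ≡⟨ m<n⇒m%n≡m a<k ⟩
      a                   ∎

  rank-later-block : ∀ {i a b p q} → i ≤ m → x (suc i) a p → x i b q → rank p < rank q
  rank-later-block {suc i} {suc a} {b} {p} {q} i<m xp@(at _ _ a<k _) xq = begin-strict
    rank p                            ≡⟨ rank-x xp ⟩
    (m ∸ suc i) * k + a               <⟨ +-monoʳ-< ((m ∸ suc i) * k) a<k ⟩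
    (m ∸ suc i) * k + k               ≡⟨ +-comm ((m ∸ suc i) * k) k ⟩
    suc (m ∸ suc i) * k               ≡⟨ cong (_* k) (sym (+-∸-assoc 1 i<m)) ⟩
    (m ∸ i) * k                       ≤⟨ m≤m+n _ _ ⟩
    (m ∸ i) * k + (b ∸ 1)             ≡⟨ rank-x xq ⟨
    rank q                            ∎
    where open ≤-Reasoning
  rank-later-block {zero} _ _ (at () _ _ _)

  block-mono : Block =[ rank ]⇒ _<_
  block-mono (within {i} {suc a} xp xq) =
    subst₂ _<_ (sym (rank-x xp)) (sym (rank-x xq)) (+-monoʳ-< ((m ∸ (i ∸ 1)) * k) ≤-refl)
  block-mono (within {a = zero} (at _ () _ _) _)
  block-mono (between i≤m xp xq) = rank-later-block i≤m xp xq

  B : FinitePoset N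
  B = generatedBy Block rank block-mono

  open FinitePoset B using () renaming (_≺_ to _≺ᴮ_)

  addRelations : (R : Rel (Fin N) 0ℓ) → R =[ rank ]⇒ _<_ → FinitePoset N
  addRelations R mono = generatedBy (_≺ᴮ_ ∪ R) rank
    λ { (inj₁ r) → closure-mono Block rank block-mono r ; (inj₂ r) → mono r }

  P132 : FinitePoset N
  P132 = addRelations Extra132 λ { (extra i≤m xp xq) → rank-later-block i≤m xp xq }

  P213 : FinitePoset N
  P213 = addRelations Extra213 λ { (extra i≤m xp xq) → rank-later-block i≤m xp xq }

-- In 𝒟 every window of three consecutive positions lies inside a block, or has
-- its only descent as second step (132 or 231) or as first step (213 or 312).
-- Avoiding one of these four patterns thus prescribes, at every block boundary,
-- the comparison of the outer two entries of one such window.  For 132 and 213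
-- these comparisons are the extra relations of the posets.  Avoiding 231 forces
-- the first entry to be the least one when no descent follows it; when a
-- descent does follow, the second entry is the least of the others, and the
-- first may take any value except the least.  Removing the first entry again
-- and again therefore multiplies the count by r for each r such that some
-- non-initial block starts with r entries remaining, and by 1 otherwise.  The
-- reverse-complement turns 312 into 231 and reverses the order of the blocks.

{-# OPTIONS --safe #-}
module Submission where

open import Defs
open import Data.Fin using (Fin; zero; suc; toℕ; fromℕ<; combine; remQuot; punchIn; opposite)
import Data.Fin as Fin
open import Data.Fin.Patterns using (0F; 1F; 2F)
open import Data.Fin.Permutation as Perm
  using (Permutation′; _⟨$⟩ʳ_; _⟨$⟩ˡ_; _≈_; _∘ₚ_; reverse; insert; remove; punchIn-permute)
import Data.Fin.Properties as Fin
open import Data.List using (applyUpTo; []; _∷_; _∷ʳ_)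
open import Data.List.Properties using (applyUpTo-∷ʳ)
open import Data.Nat
  using (ℕ; zero; suc; NonZero; ≢-nonZero; >-nonZero; _+_; _*_; _∸_; _^_; _!;
    _≤_; _<_; z≤n; s≤s; s≤s⁻¹; z<s)
open import Data.Nat.Divisibility
open import Data.Nat.DivMod using (_/_; _%_; m≡m%n+[m/n]*n; m%n<n; m*n/n≡m; /-monoˡ-≤; m/n*n≤m)
open import Data.Nat.ListAction using (product)
open import Data.Nat.ListAction.Properties using (product-++)
open import Data.Nat.Properties
open import Data.Nat.Solver using (module +-*-Solver)
open import Data.Product using (Σ; ∃; ∃₂; _×_; _,_; proj₁; proj₂; uncurry)
open import Data.Sum using (_⊎_; inj₁; inj₂)
open import Data.Unit using (tt)
open import Data.Vec using (lookup; []; _∷_)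
open import Function using (Inverse; Injection; Equivalence; _⇔_; mk⇔; _∘_; id)
import Function.Construct.Composition as Compose
open import Function.Properties.Inverse using (↔⇒↣)
open import Level using (0ℓ)
open import Relation.Binary using (Rel; _=[_]⇒_; tri<; tri≈; tri>)
open import Relation.Binary.Construct.Closure.Transitive using ([_])
import Relation.Binary.Construct.On as On
open import Relation.Binary.PropositionalEquality
open import Relation.Nullary using (¬_; Dec; yes; no; contradiction)
open import Relation.Nullary.Decidable using (_→-dec_; _×-dec_; ¬?; map′)
open import Relation.Unary using (Pred; Decidable; _≐_; U; _∩_)
open import Relation.Unary.Properties using (≐-sym)
open +-*-Solver using (solve; _:=_; _:+_; _:*_; con)

-- Sizes of sets of permutations.

⟦⟧-transport : ∀ {N c} {P Q : Pred (Permutation′ N) 0ℓ}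
  (φ : Permutation′ N → Permutation′ N) →
  (∀ {π ρ} → π ≈ ρ → φ π ≈ φ ρ) → (∀ π → φ (φ π) ≈ π) →
  (∀ {π} → P π → Q (φ π)) → (∀ {π} → Q π → P (φ π)) →
  ⟦ P ⟧ HasSize c → ⟦ Q ⟧ HasSize c
⟦⟧-transport {P = P} {Q} φ φ-cong φ-invol P⇒Q Q⇒P = Compose.inverse Q↔P
  where
  Q↔P : Inverse ⟦ Q ⟧ ⟦ P ⟧
  Q↔P = record
    { to        = λ (π , q) → φ π , Q⇒P q
    ; from      = λ (π , p) → φ π , P⇒Q p
    ; to-cong   = φ-cong
    ; from-cong = φ-cong
    ; inverse   = (λ {π} y≈ i → trans (φ-cong y≈ i) (φ-invol (proj₁ π) i))
                , (λ {π} y≈ i → trans (φ-cong y≈ i) (φ-invol (proj₁ π) i))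
    }

⟦⟧-cong : ∀ {N c} {P Q : Pred (Permutation′ N) 0ℓ} → P ≐ Q → ⟦ P ⟧ HasSize c → ⟦ Q ⟧ HasSize c
⟦⟧-cong (P⊆Q , Q⊆P) = ⟦⟧-transport id id (λ _ _ → refl) P⊆Q Q⊆P

empty-size : ∀ {N} {P : Pred (Permutation′ N) 0ℓ} → (∀ π → ¬ P π) → ⟦ P ⟧ HasSize 0
empty-size ¬P = record
  { to        = λ (π , p) → contradiction p (¬P π)
  ; from      = λ ()
  ; to-cong   = λ { {π , p} → contradiction p (¬P π) }
  ; from-cong = λ { {()} }
  ; inverse   = (λ { {()} }) , λ { {π , p} → contradiction p (¬P π) }
  }

insert-suc : ∀ {n} (v : Fin (suc n)) (π : Permutation′ n) i →
  insert zero v π ⟨$⟩ʳ suc i ≡ punchIn v (π ⟨$⟩ʳ i)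
insert-suc v π = Perm.insert-punchIn zero v π

remove-cong : ∀ {n} {π ρ : Permutation′ (suc n)} → π ≈ ρ → remove zero π ≈ remove zero ρ
remove-cong {π = π} {ρ} π≈ρ i = Fin.punchIn-injective (π ⟨$⟩ʳ zero) _ _ (begin
  punchIn (π ⟨$⟩ʳ zero) (remove zero π ⟨$⟩ʳ i)  ≡⟨ punchIn-permute π zero i ⟨
  π ⟨$⟩ʳ suc i                                  ≡⟨ π≈ρ (suc i) ⟩
  ρ ⟨$⟩ʳ suc i                                  ≡⟨ punchIn-permute ρ zero i ⟩
  punchIn (ρ ⟨$⟩ʳ zero) (remove zero ρ ⟨$⟩ʳ i)
    ≡⟨ cong (λ v → punchIn v (remove zero ρ ⟨$⟩ʳ i)) (π≈ρ zero) ⟨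
  punchIn (π ⟨$⟩ʳ zero) (remove zero ρ ⟨$⟩ʳ i)  ∎)
  where open ≡-Reasoning

insert-cong : ∀ {n} (v : Fin (suc n)) {π ρ : Permutation′ n} → π ≈ ρ →
  insert zero v π ≈ insert zero v ρ
insert-cong v π≈ρ zero = refl
insert-cong v {π} {ρ} π≈ρ (suc i) =
  trans (insert-suc v π i) (trans (cong (punchIn v) (π≈ρ i)) (sym (insert-suc v ρ i)))

module _ {n c d : ℕ} {P : Pred (Permutation′ (suc n)) 0ℓ} {Q : Pred (Permutation′ n) 0ℓ}
  (Q-resp : ∀ {π ρ} → π ≈ ρ → Q π → Q ρ)
  (ι : Fin c → Fin (suc n)) (ι-injective : ∀ {v w} → ι v ≡ ι w → v ≡ w)
  (P⇒ : ∀ {π} → P π → (∃ λ v → π ⟨$⟩ʳ zero ≡ ι v) × Q (remove zero π))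
  (⇒P : ∀ {π} → (∃ λ v → π ⟨$⟩ʳ zero ≡ ι v) → Q (remove zero π) → P π)
  where

  -- A permutation is determined by its first value and the standardised remainder. When `P` amounts
  -- to a first value enumerated by `ι` and, independently, a remainder in `Q`, the sizes multiply.
  ⟦⟧-remove : ⟦ Q ⟧ HasSize d → ⟦ P ⟧ HasSize (c * d)
  ⟦⟧-remove Q↔ = record
    { to        = to
    ; from      = λ j → fromPair (remQuot {c} d j)
    ; to-cong   = λ {π} {ρ} → to-cong {π} {ρ}
    ; from-cong = λ { refl i → refl }
    ; inverse   = (λ {j} {π} → to-from {j} {π}) , (λ { {π} refl → from-to π })
    }
    where
    module Q↔ = Inverse Q↔

    first : Σ (Permutation′ (suc n)) P → Fin c
    first (π , p) = proj₁ (proj₁ (P⇒ p))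

    first-spec : ∀ π → proj₁ π ⟨$⟩ʳ zero ≡ ι (first π)
    first-spec (π , p) = proj₂ (proj₁ (P⇒ p))

    rest : Σ (Permutation′ (suc n)) P → Σ (Permutation′ n) Q
    rest (π , p) = remove zero π , proj₂ (P⇒ p)

    to : Σ (Permutation′ (suc n)) P → Fin (c * d)
    to π = combine (first π) (Q↔.to (rest π))

    fromPair : Fin c × Fin d → Σ (Permutation′ (suc n)) P
    fromPair (v , j) = let (ρ , q) = Q↔.from j in
      insert zero (ι v) ρ ,
      ⇒P (v , refl) (Q-resp (λ i → sym (Perm.remove-insert zero (ι v) ρ i)) q)

    to-cong : ∀ {π ρ} → proj₁ π ≈ proj₁ ρ → to π ≡ to ρ
    to-cong {π} {ρ} π≈ρ = cong₂ combine
      (ι-injective (trans (sym (first-spec π)) (trans (π≈ρ zero) (first-spec ρ))))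
      (Q↔.to-cong (remove-cong {π = proj₁ π} {proj₁ ρ} π≈ρ))

    to-fromPair : ∀ vj → to (fromPair vj) ≡ uncurry combine vj
    to-fromPair (v , j) = cong₂ combine
      (ι-injective (sym (first-spec (fromPair (v , j)))))
      (Q↔.inverseˡ (Perm.remove-insert zero (ι v) (proj₁ (Q↔.from j))))

    to-from : ∀ {j π} → proj₁ π ≈ proj₁ (fromPair (remQuot {c} d j)) → to π ≡ j
    to-from {j} {π} π≈ = trans (to-cong {π} {fromPair (remQuot {c} d j)} π≈)
      (trans (to-fromPair (remQuot {c} d j)) (Fin.combine-remQuot {c} d j))

    fromPair-to : ∀ π → proj₁ (fromPair (first π , Q↔.to (rest π))) ≈ proj₁ π
    fromPair-to π i = begin
      insert zero (ι (first π)) ρ ⟨$⟩ʳ i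
        ≡⟨ cong (λ v → insert zero v ρ ⟨$⟩ʳ i) (first-spec π) ⟨
      insert zero (proj₁ π ⟨$⟩ʳ zero) ρ ⟨$⟩ʳ i
        ≡⟨ insert-cong _ {ρ} {remove zero (proj₁ π)} (Q↔.inverseʳ refl) i ⟩
      insert zero (proj₁ π ⟨$⟩ʳ zero) (remove zero (proj₁ π)) ⟨$⟩ʳ i
        ≡⟨ Perm.insert-remove zero (proj₁ π) i ⟩
      proj₁ π ⟨$⟩ʳ i ∎
      where
      open ≡-Reasoning
      ρ = proj₁ (Q↔.from (Q↔.to (rest π)))

    from-to : ∀ π → proj₁ (fromPair (remQuot {c} d (to π))) ≈ proj₁ π
    from-to π = subst (λ vj → proj₁ (fromPair vj) ≈ proj₁ π)
      (sym (Fin.remQuot-combine (first π) (Q↔.to (rest π)))) (fromPair-to π)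

permutations-size : ∀ n → ⟦ U {A = Permutation′ n} ⟧ HasSize (n !)
permutations-size zero = record
  { to        = λ _ → zero
  ; from      = λ _ → Perm.id , tt
  ; to-cong   = λ _ → refl
  ; from-cong = λ _ ()
  ; inverse   = (λ { {zero} _ → refl }) , λ _ ()
  }
permutations-size (suc n) =
  ⟦⟧-remove (λ _ _ → tt) id id (λ _ → (_ , refl) , tt) (λ _ _ → tt) (permutations-size n)

filter-size : ∀ {M} {P : Pred (Fin M) 0ℓ} → Decidable P →
  ∃ λ c → On.setoid {B = Σ (Fin M) P} (setoid (Fin M)) proj₁ HasSize c
filter-size {zero} P? = 0 , record
  { to        = λ { (() , _) }
  ; from      = λ ()
  ; to-cong   = λ { {() , _} }
  ; from-cong = λ { {()} }
  ; inverse   = (λ { {()} }) , λ { {() , _} }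
  }
filter-size {suc M} {P} P? with P? zero | filter-size {P = P ∘ suc} (P? ∘ suc)
... | yes p₀ | c , S = suc c , record
  { to        = to
  ; from      = from
  ; to-cong   = to-cong
  ; from-cong = λ { refl → refl }
  ; inverse   = (λ {j} → to-from {j}) , (λ { {i} refl → from-to i })
  }
  where
  module S = Inverse S
  to : Σ (Fin (suc M)) P → Fin (suc c)
  to (zero , _)  = zero
  to (suc i , p) = suc (S.to (i , p))
  from : Fin (suc c) → Σ (Fin (suc M)) P
  from zero    = zero , p₀
  from (suc j) = let (i , p) = S.from j in suc i , p
  to-cong : ∀ {i j} → proj₁ i ≡ proj₁ j → to i ≡ to j
  to-cong {zero , _}  {zero , _}  _  = refl
  to-cong {suc i , _} {suc j , _} eq = cong suc (S.to-cong (Fin.suc-injective eq))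
  to-from : ∀ {j i} → proj₁ i ≡ proj₁ (from j) → to i ≡ j
  to-from {zero}  {zero , _}  _  = refl
  to-from {suc j} {suc i , _} eq = cong suc (S.inverseˡ (Fin.suc-injective eq))
  from-to : ∀ i → proj₁ (from (to i)) ≡ proj₁ i
  from-to (zero , _)  = refl
  from-to (suc i , p) = cong suc (S.inverseʳ refl)
... | no ¬p₀ | c , S = c , record
  { to        = to
  ; from      = from
  ; to-cong   = to-cong
  ; from-cong = λ { refl → refl }
  ; inverse   = (λ {j} → to-from {j}) , (λ { {i} refl → from-to i })
  }
  where
  module S = Inverse S
  to : Σ (Fin (suc M)) P → Fin c
  to (zero , p)  = contradiction p ¬p₀
  to (suc i , p) = S.to (i , p)
  from : Fin c → Σ (Fin (suc M)) P
  from j = let (i , p) = S.from j in suc i , p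
  to-cong : ∀ {i j} → proj₁ i ≡ proj₁ j → to i ≡ to j
  to-cong {zero , p}  _  = contradiction p ¬p₀
  to-cong {suc i , _} {suc j , _} eq = S.to-cong (Fin.suc-injective eq)
  to-from : ∀ {j i} → proj₁ i ≡ proj₁ (from j) → to i ≡ j
  to-from {j} {suc i , _} eq = S.inverseˡ (Fin.suc-injective eq)
  from-to : ∀ i → proj₁ (from (to i)) ≡ proj₁ i
  from-to (zero , p)  = contradiction p ¬p₀
  from-to (suc i , p) = cong suc (S.inverseʳ refl)

-- Filtering an enumeration of all `N !` permutations yields the size. `P` has to respect `≈`
-- because the enumeration returns a permutation only up to `≈`.
decidable-size : ∀ {N} {P : Pred (Permutation′ N) 0ℓ} → Decidable P →
  (∀ {π ρ} → π ≈ ρ → P π → P ρ) → ∃ λ c → ⟦ P ⟧ HasSize c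
decidable-size {N} {P} P? P-resp = c , Compose.inverse P↔F F↔
  where
  module E = Inverse (permutations-size N)
  enum : Fin (N !) → Permutation′ N
  enum j = proj₁ (E.from j)
  filtered = filter-size (P? ∘ enum)
  c = proj₁ filtered
  F↔ = proj₂ filtered
  P↔F : Inverse ⟦ P ⟧ (On.setoid {B = Σ (Fin (N !)) (P ∘ enum)} (setoid (Fin (N !))) proj₁)
  P↔F = record
    { to        = λ (π , p) → E.to (π , tt) , P-resp (λ i → sym (E.inverseʳ {π , tt} refl i)) p
    ; from      = λ (j , p) → enum j , p
    ; to-cong   = E.to-cong
    ; from-cong = λ { refl _ → refl }
    ; inverse   = E.inverseˡ , E.inverseʳ
    }

-- Windows of three consecutive entries and consecutive patterns.

Triples : ∀ {n} → (Fin n → Fin n → Fin n → Set) → Set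
Triples R = ∀ {a b c} → toℕ b ≡ suc (toℕ a) → toℕ c ≡ suc (toℕ b) → R a b c

-- D is meant to hold of the first positions of the blocks, so that the descents
-- are the steps ending in D.  A window abc with a descent from b to c ascends
-- from a to b, since D is sparse; it is therefore a 132 or a 231, and which of
-- the two is decided by the comparison of a with c.  Likewise for 213 and 312
-- when the descent leads from a to b.
module _ {n : ℕ} (D : Pred (Fin n) 0ℓ) where

  Ordered Peak231 Peak132 Valley312 Valley213 : Pred (Permutation′ n) 0ℓ
  Ordered π   = ∀ {p q} → toℕ q ≡ suc (toℕ p) →
    (D q → π ⟨$⟩ʳ q Fin.< π ⟨$⟩ʳ p) × (¬ D q → π ⟨$⟩ʳ p Fin.< π ⟨$⟩ʳ q)
  Peak231 π   = Triples λ a b c → D c → π ⟨$⟩ʳ c Fin.< π ⟨$⟩ʳ a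
  Peak132 π   = Triples λ a b c → D c → π ⟨$⟩ʳ a Fin.< π ⟨$⟩ʳ c
  Valley312 π = Triples λ a b c → D b → π ⟨$⟩ʳ c Fin.< π ⟨$⟩ʳ a
  Valley213 π = Triples λ a b c → D b → π ⟨$⟩ʳ a Fin.< π ⟨$⟩ʳ c

injective : ∀ {n} (π : Permutation′ n) {i j} → π ⟨$⟩ʳ i ≡ π ⟨$⟩ʳ j → i ≡ j
injective π = Injection.injective (↔⇒↣ π)

preimage : ∀ {n} (π : Permutation′ n) {i j} → π ⟨$⟩ˡ j ≡ i → π ⟨$⟩ʳ i ≡ j
preimage π eq = trans (cong (π ⟨$⟩ʳ_) (sym eq)) (Perm.inverseʳ π)

≮⇒> : ∀ {n} (π : Permutation′ n) {i j} → toℕ i ≢ toℕ j →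
  ¬ (π ⟨$⟩ʳ i Fin.< π ⟨$⟩ʳ j) → π ⟨$⟩ʳ j Fin.< π ⟨$⟩ʳ i
≮⇒> π i≢j ¬< = ≤∧≢⇒< (≮⇒≥ ¬<) λ eq →
  i≢j (cong toℕ (injective π (Fin.toℕ-injective (sym eq))))

consecutive-≢ : ∀ {n} {p q : Fin n} → toℕ q ≡ suc (toℕ p) → toℕ p ≢ toℕ q
consecutive-≢ q≡1+p p≡q = 1+n≢n (trans (sym q≡1+p) (sym p≡q))

consecutive-≢₂ : ∀ {n} {a b c : Fin n} → toℕ b ≡ suc (toℕ a) → toℕ c ≡ suc (toℕ b) → toℕ a ≢ toℕ c
consecutive-≢₂ b≡1+a c≡1+b = <⇒≢ (<-trans (≤-reflexive (sym b≡1+a)) (≤-reflexive (sym c≡1+b)))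

window : ∀ {n} → Fin n → Fin n → Fin n → Fin 3 → Fin n
window a b c = lookup (a ∷ b ∷ c ∷ [])

-- `p ⟨$⟩ˡ x` is the place of the `x`-th smallest entry of `p`, so the window is read in the order
-- of the pattern's values. Two inequalities then stand for the nine equivalences in `Contains`.
Chain : ∀ {n} → Permutation′ n → Permutation′ 3 → (Fin 3 → Fin n) → Set
Chain π p w =
  π ⟨$⟩ʳ w (p ⟨$⟩ˡ 0F) Fin.< π ⟨$⟩ʳ w (p ⟨$⟩ˡ 1F) ×
  π ⟨$⟩ʳ w (p ⟨$⟩ˡ 1F) Fin.< π ⟨$⟩ʳ w (p ⟨$⟩ˡ 2F)

-- The chain makes the window follow the order of `p`; the converse direction of each equivalence
-- then comes from trichotomy on the values of `p`.
contains : ∀ {n} (π : Permutation′ n) p {a b c : Fin n} →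
  toℕ b ≡ suc (toℕ a) → toℕ c ≡ suc (toℕ b) → Chain π p (window a b c) → Contains π p
contains {n} π p {a} {b} {c} b≡1+a c≡1+b (v₀<v₁ , v₁<v₂) =
  toℕ a , w , position , λ u v → mk⇔ (preserve u v) (reflect u v)
  where
  w = window a b c

  position : ∀ u → toℕ (w u) ≡ toℕ a + toℕ u
  position 0F = sym (+-identityʳ _)
  position 1F = trans b≡1+a (+-comm 1 _)
  position 2F = trans c≡1+b (trans (cong suc b≡1+a) (+-comm 2 _))

  value : Fin 3 → Fin n
  value x = π ⟨$⟩ʳ w (p ⟨$⟩ˡ x)

  value-mono : ∀ x y → x Fin.< y → value x Fin.< value y
  value-mono 0F 1F _ = v₀<v₁
  value-mono 0F 2F _ = <-trans v₀<v₁ v₁<v₂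
  value-mono 1F 2F _ = v₁<v₂
  value-mono 1F 1F (s≤s ())
  value-mono 2F 1F (s≤s ())
  value-mono 2F 2F (s≤s (s≤s ()))

  preserve : ∀ u v → p ⟨$⟩ʳ u Fin.< p ⟨$⟩ʳ v → π ⟨$⟩ʳ w u Fin.< π ⟨$⟩ʳ w v
  preserve u v u<v = subst₂ (λ x y → π ⟨$⟩ʳ w x Fin.< π ⟨$⟩ʳ w y)
    (Perm.inverseˡ p) (Perm.inverseˡ p) (value-mono _ _ u<v)

  reflect : ∀ u v → π ⟨$⟩ʳ w u Fin.< π ⟨$⟩ʳ w v → p ⟨$⟩ʳ u Fin.< p ⟨$⟩ʳ v
  reflect u v u<v with Fin.<-cmp (p ⟨$⟩ʳ u) (p ⟨$⟩ʳ v)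
  ... | tri< pu<pv _ _ = pu<pv
  ... | tri≈ _ pu≡pv _ = contradiction (cong (λ x → toℕ (π ⟨$⟩ʳ w x)) (injective p pu≡pv)) (<⇒≢ u<v)
  ... | tri> _ _ pv<pu = contradiction (preserve v u pv<pu) (<-asym u<v)

contains⁻¹ : ∀ {n} (π : Permutation′ n) p → Contains π p → ∃₂ λ a b → ∃ λ c →
  toℕ b ≡ suc (toℕ a) × toℕ c ≡ suc (toℕ b) × Chain π p (window a b c)
contains⁻¹ π p (i , pos , position , iso) =
  pos 0F , pos 1F , pos 2F , step 0F 1F refl , step 1F 2F refl ,
  value-mono 0F 1F z<s , value-mono 1F 2F (s≤s z<s)
  where
  step : ∀ u v → toℕ v ≡ suc (toℕ u) → toℕ (pos v) ≡ suc (toℕ (pos u))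
  step u v v≡1+u = begin
    toℕ (pos v)        ≡⟨ position v ⟩
    i + toℕ v          ≡⟨ cong (i +_) v≡1+u ⟩
    i + suc (toℕ u)    ≡⟨ +-suc i (toℕ u) ⟩
    suc (i + toℕ u)    ≡⟨ cong suc (position u) ⟨
    suc (toℕ (pos u))  ∎
    where open ≡-Reasoning

  pos≡window : ∀ u → pos u ≡ window (pos 0F) (pos 1F) (pos 2F) u
  pos≡window 0F = refl
  pos≡window 1F = refl
  pos≡window 2F = refl

  value-mono : ∀ x y → x Fin.< y →
    π ⟨$⟩ʳ window (pos 0F) (pos 1F) (pos 2F) (p ⟨$⟩ˡ x) Fin.<
    π ⟨$⟩ʳ window (pos 0F) (pos 1F) (pos 2F) (p ⟨$⟩ˡ y)
  value-mono x y x<y = subst₂ (λ u v → π ⟨$⟩ʳ u Fin.< π ⟨$⟩ʳ v) (pos≡window _) (pos≡window _)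
    (Equivalence.to (iso (p ⟨$⟩ˡ x) (p ⟨$⟩ˡ y))
      (subst₂ Fin._<_ (sym (Perm.inverseʳ p)) (sym (Perm.inverseʳ p)) x<y))

module _ {n : ℕ} {D : Pred (Fin n) 0ℓ} {π : Permutation′ n}
  (sparse : ∀ {p q} → toℕ q ≡ suc (toℕ p) → D p → ¬ D q) (ordered : Ordered D π) where

  private
    ascent : ∀ {p q} → toℕ q ≡ suc (toℕ p) → π ⟨$⟩ʳ p Fin.< π ⟨$⟩ʳ q → ¬ D q
    ascent q≡1+p p<q Dq = <-asym p<q (proj₁ (ordered q≡1+p) Dq)

  -- Two descents in a row would put two adjacent positions into `D`.
  avoids-321 : Avoids p321 π
  avoids-321 321∈π with contains⁻¹ π p321 321∈π
  ... | a , b , c , b≡1+a , c≡1+b , c<b , b<a =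
    <-asym c<b (proj₂ (ordered c≡1+b) λ Dc →
      <-asym b<a (proj₂ (ordered b≡1+a) λ Db → sparse c≡1+b Db Dc))

  -- Two ascents in a row would leave two adjacent positions outside `D`.
  avoids-123 : Triples (λ a b c → ¬ D b → ¬ ¬ D c) → Avoids p123 π
  avoids-123 dense 123∈π with contains⁻¹ π p123 123∈π
  ... | a , b , c , b≡1+a , c≡1+b , a<b , b<c =
    dense b≡1+a c≡1+b (ascent b≡1+a a<b) (ascent c≡1+b b<c)

module _ {n : ℕ} {D : Pred (Fin n) 0ℓ} (D? : Decidable D)
  (sparse : ∀ {p q} → toℕ q ≡ suc (toℕ p) → D p → ¬ D q)
  {π : Permutation′ n} (ordered : Ordered D π) where

  private
    descent : ∀ {p q} → toℕ q ≡ suc (toℕ p) → π ⟨$⟩ʳ q Fin.< π ⟨$⟩ʳ p → D q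
    descent {p} {q} q≡1+p q<p with D? q
    ... | yes Dq = Dq
    ... | no ¬Dq = contradiction (proj₂ (ordered q≡1+p) ¬Dq) (<-asym q<p)

  -- Each condition is named after the pattern that remains: once 132 is avoided, every window
  -- descending in its second step is a 231. The other three equivalences follow the same scheme.
  avoids-132⇔ : Avoids p132 π ⇔ Peak231 D π
  avoids-132⇔ = mk⇔
    (λ avoids {a} {b} {c} b≡1+a c≡1+b Dc → ≮⇒> π (consecutive-≢₂ b≡1+a c≡1+b) λ a<c →
      avoids (contains π p132 b≡1+a c≡1+b (a<c , proj₁ (ordered c≡1+b) Dc)))
    λ peak 132∈π → let (a , b , c , b≡1+a , c≡1+b , a<c , c<b) = contains⁻¹ π p132 132∈π in
      <-asym a<c (peak b≡1+a c≡1+b (descent c≡1+b c<b))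

  avoids-231⇔ : Avoids p231 π ⇔ Peak132 D π
  avoids-231⇔ = mk⇔
    (λ avoids {a} {b} {c} b≡1+a c≡1+b Dc → ≮⇒> π (consecutive-≢₂ b≡1+a c≡1+b ∘ sym) λ c<a →
      -- Sparseness makes the step before a descent an ascent, which completes the chain of a 231.
      avoids (contains π p231 b≡1+a c≡1+b (c<a , proj₂ (ordered b≡1+a) λ Db → sparse c≡1+b Db Dc)))
    λ peak 231∈π → let (a , b , c , b≡1+a , c≡1+b , c<a , a<b) = contains⁻¹ π p231 231∈π in
      <-asym c<a (peak b≡1+a c≡1+b (descent c≡1+b (<-trans c<a a<b)))

  avoids-213⇔ : Avoids p213 π ⇔ Valley312 D π
  avoids-213⇔ = mk⇔
    (λ avoids {a} {b} {c} b≡1+a c≡1+b Db → ≮⇒> π (consecutive-≢₂ b≡1+a c≡1+b) λ a<c →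
      avoids (contains π p213 b≡1+a c≡1+b (proj₁ (ordered b≡1+a) Db , a<c)))
    λ valley 213∈π → let (a , b , c , b≡1+a , c≡1+b , b<a , a<c) = contains⁻¹ π p213 213∈π in
      <-asym a<c (valley b≡1+a c≡1+b (descent b≡1+a b<a))

  avoids-312⇔ : Avoids p312 π ⇔ Valley213 D π
  avoids-312⇔ = mk⇔
    (λ avoids {a} {b} {c} b≡1+a c≡1+b Db → ≮⇒> π (consecutive-≢₂ b≡1+a c≡1+b ∘ sym) λ c<a →
      avoids (contains π p312 b≡1+a c≡1+b (proj₂ (ordered c≡1+b) (sparse c≡1+b Db) , c<a)))
    λ valley 312∈π → let (a , b , c , b≡1+a , c≡1+b , b<c , c<a) = contains⁻¹ π p312 312∈π in
      <-asym c<a (valley b≡1+a c≡1+b (descent b≡1+a (<-trans b<c c<a)))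

-- Block starts and the descent condition.

Start : ∀ {N} → ℕ → Pred (Fin N) 0ℓ
Start k q = k ∣ toℕ q

start? : ∀ {N} k → Decidable (Start {N} k)
start? k q = k ∣? toℕ q

-- Otherwise `k` would divide the difference 1.
∣-sparse : ∀ {k n} → 2 ≤ k → k ∣ n → k ∤ suc n
∣-sparse {k} {n} 2≤k k∣n k∣1+n =
  <⇒≱ 2≤k (≤-reflexive (∣1⇒≡1 (∣m+n∣m⇒∣n (subst (k ∣_) (+-comm 1 n) k∣1+n) k∣n)))

start-sparse : ∀ {N k} → 2 ≤ k → ∀ {p q : Fin N} → toℕ q ≡ suc (toℕ p) → Start k p → ¬ Start k q
start-sparse {k = k} 2≤k q≡1+p k∣p k∣q = ∣-sparse 2≤k k∣p (subst (k ∣_) q≡1+p k∣q)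

2∤⇒2∣suc : ∀ n → 2 ∤ n → 2 ∣ suc n
2∤⇒2∣suc zero          2∤0 = contradiction (2 ∣0) 2∤0
2∤⇒2∣suc (suc zero)    _   = ∣-refl
2∤⇒2∣suc (suc (suc n)) 2∤  = ∣m∣n⇒∣m+n ∣-refl (2∤⇒2∣suc n λ 2∣n → 2∤ (∣m∣n⇒∣m+n ∣-refl 2∣n))

start⇒multiple : ∀ {N k} .{{_ : NonZero k}} {p q : Fin N} → toℕ q ≡ suc (toℕ p) →
  Start k q → Multiples N k (toℕ q)
start⇒multiple {N} {k} {p} {q} q≡1+p (divides j q≡j*k) = j , 1≤j j q≡j*k , j≤ , q≡j*k
  where
  1≤j : ∀ j → toℕ q ≡ j * k → 1 ≤ j
  1≤j zero    q≡0 = contradiction (trans (sym q≡1+p) q≡0) λ ()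
  1≤j (suc j) _   = z<s
  j≤ : j ≤ (N ∸ 1) / k
  j≤ = begin
    j            ≡⟨ m*n/n≡m j k ⟨
    j * k / k    ≡⟨ cong (_/ k) q≡j*k ⟨
    toℕ q / k    ≤⟨ /-monoˡ-≤ k (<⇒≤pred (Fin.toℕ<n q)) ⟩
    (N ∸ 1) / k  ∎
    where open ≤-Reasoning

-- The 1-based descent `d` is the step ending at the 0-based position `d`. Prescribing the descent
-- set therefore prescribes the direction of every step: down into a block start, up elsewhere.
𝒟≐Ordered : ∀ {N k} .{{_ : NonZero k}} → 𝒟 N k ≐ Ordered (Start k)
𝒟≐Ordered {N} {k} = (λ {π} → to {π}) , (λ {π} ordered → from⊆ {π} ordered , from⊇ {π} ordered)
  where
  to : ∀ {π} → 𝒟 N k π → Ordered (Start k) π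
  to {π} (Des⊆ , ⊆Des) {p} {q} q≡1+p = descent , ascent
    where
    descent : Start k q → π ⟨$⟩ʳ q Fin.< π ⟨$⟩ʳ p
    descent k∣q with ⊆Des (start⇒multiple q≡1+p k∣q)
    ... | p′ , q′ , 1+p′≡q , q′≡q , q<p = subst₂ (λ x y → π ⟨$⟩ʳ y Fin.< π ⟨$⟩ʳ x)
      (Fin.toℕ-injective (suc-injective (trans 1+p′≡q q≡1+p))) (Fin.toℕ-injective q′≡q) q<p
    ascent : ¬ Start k q → π ⟨$⟩ʳ p Fin.< π ⟨$⟩ʳ q
    ascent k∤q = ≮⇒> π (consecutive-≢ q≡1+p ∘ sym) λ q<p →
      let (j , _ , _ , q≡j*k) = Des⊆ (p , q , sym q≡1+p , refl , q<p) in k∤q (divides j q≡j*k)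

  from⊆ : ∀ {π} → Ordered (Start k) π → ∀ {d} → Des π d → Multiples N k d
  from⊆ {π} ordered {d} (p , q , 1+p≡d , q≡d , q<p) with start? k q
  ... | no k∤q  = contradiction (proj₂ (ordered (trans q≡d (sym 1+p≡d))) k∤q) (<-asym q<p)
  ... | yes k∣q = subst (Multiples N k) q≡d (start⇒multiple (trans q≡d (sym 1+p≡d)) k∣q)

  from⊇ : ∀ {π} → Ordered (Start k) π → ∀ {d} → Multiples N k d → Des π d
  from⊇ {π} ordered {d} (j , 1≤j , j≤ , d≡j*k) =
    p , q , 1+p≡d , q≡d , proj₁ (ordered (trans q≡d (sym 1+p≡d))) (divides j (trans q≡d d≡j*k))
    where
    d≤N∸1 : d ≤ N ∸ 1
    d≤N∸1 = ≤-trans (≤-reflexive d≡j*k) (≤-trans (*-monoˡ-≤ k j≤) (m/n*n≤m (N ∸ 1) k))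
    d≢0 : d ≢ 0
    d≢0 d≡0 = contradiction (m*n≡0⇒m≡0 j k (trans (sym d≡j*k) d≡0)) (>⇒≢ 1≤j)
    instance
      d-nonZero : NonZero d
      d-nonZero = ≢-nonZero d≢0
    N≢0 : N ≢ 0
    N≢0 refl = d≢0 (n≤0⇒n≡0 d≤N∸1)
    instance
      N-nonZero : NonZero N
      N-nonZero = ≢-nonZero N≢0
    d<N : d < N
    d<N = subst (d <_) (suc-pred N) (s≤s d≤N∸1)
    q p : Fin N
    q = fromℕ< d<N
    p = fromℕ< (≤-<-trans (pred[n]≤n {d}) d<N)
    q≡d : toℕ q ≡ d
    q≡d = Fin.toℕ-fromℕ< d<N
    1+p≡d : suc (toℕ p) ≡ d
    1+p≡d = trans (cong suc (Fin.toℕ-fromℕ< _)) (suc-pred d)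

-- Decidability and invariance of the conditions.

∀-dec : ∀ {N} {P : Fin N → Set} → Decidable P → Dec (∀ {i} → P i)
∀-dec P? = map′ (λ f {i} → f i) (λ f i → f {i}) (Fin.all? P?)

ordered? : ∀ {N} {D : Pred (Fin N) 0ℓ} → Decidable D → Decidable (Ordered D)
ordered? D? π = ∀-dec λ p → ∀-dec λ q → (toℕ q ≟ suc (toℕ p)) →-dec
  ((D? q →-dec (_ Fin.<? _)) ×-dec (¬? (D? q) →-dec (_ Fin.<? _)))

triples? : ∀ {N} {R : Fin N → Fin N → Fin N → Set} → (∀ a b c → Dec (R a b c)) → Dec (Triples R)
triples? R? = ∀-dec λ a → ∀-dec λ b → ∀-dec λ c →
  (toℕ b ≟ suc (toℕ a)) →-dec ((toℕ c ≟ suc (toℕ b)) →-dec R? a b c)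

-- The conditions conclude only strict comparisons between values, so it is enough to transfer these
-- from `π` to `ρ` in one direction.
OrderInvariant : ∀ {N} → Pred (Permutation′ N) 0ℓ → Set
OrderInvariant T = ∀ π ρ →
  (∀ {i j} → π ⟨$⟩ʳ i Fin.< π ⟨$⟩ʳ j → ρ ⟨$⟩ʳ i Fin.< ρ ⟨$⟩ʳ j) → T π → T ρ

≈-resp : ∀ {N} {T : Pred (Permutation′ N) 0ℓ} → OrderInvariant T → ∀ {π ρ} → π ≈ ρ → T π → T ρ
≈-resp T-inv {π} {ρ} π≈ρ = T-inv π ρ (subst₂ Fin._<_ (π≈ρ _) (π≈ρ _))

∩-invariant : ∀ {N} {S T : Pred (Permutation′ N) 0ℓ} →
  OrderInvariant S → OrderInvariant T → OrderInvariant (S ∩ T)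
∩-invariant S-inv T-inv π ρ mono (s , t) = S-inv π ρ mono s , T-inv π ρ mono t

module _ {N : ℕ} (D : Pred (Fin N) 0ℓ) where

  ordered-invariant : OrderInvariant (Ordered D)
  ordered-invariant π ρ mono ordered q≡1+p =
    mono ∘ proj₁ (ordered q≡1+p) , mono ∘ proj₂ (ordered q≡1+p)

  peak231-invariant : OrderInvariant (Peak231 D)
  peak231-invariant π ρ mono peak b≡1+a c≡1+b = mono ∘ peak b≡1+a c≡1+b

  peak132-invariant : OrderInvariant (Peak132 D)
  peak132-invariant π ρ mono peak b≡1+a c≡1+b = mono ∘ peak b≡1+a c≡1+b

  valley312-invariant : OrderInvariant (Valley312 D)
  valley312-invariant π ρ mono valley b≡1+a c≡1+b = mono ∘ valley b≡1+a c≡1+b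

-- Linear extensions of the block posets.

Respects : ∀ {n} → Rel (Fin n) 0ℓ → Pred (Permutation′ n) 0ℓ
Respects R π = R =[ π ⟨$⟩ʳ_ ]⇒ Fin._<_

-- The extra poset relations name only the outer positions of a window; this supplies the middle
-- one.
between-consecutive : ∀ {N} {a c : Fin N} → toℕ c ≡ suc (suc (toℕ a)) →
  ∃ λ b → toℕ b ≡ suc (toℕ a) × toℕ c ≡ suc (toℕ b)
between-consecutive {a = a} {c} c≡2+a = fromℕ< b<N , b≡1+a , trans c≡2+a (cong suc (sym b≡1+a))
  where
  b<N = <-trans (≤-reflexive (sym c≡2+a)) (Fin.toℕ<n c)
  b≡1+a = Fin.toℕ-fromℕ< b<N

module BlockPosets (m s h : ℕ) (s≤k : s ≤ suc (suc h)) where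

  -- With two successors exposed, the offsets of `x_{i,k}` and `x_{i,k-1}` inside their block
  -- compute to `suc h` and `h`.
  k : ℕ
  k = suc (suc h)

  open Blocks m s k

  -- Multiple 0 is excluded because `q` has a predecessor, and `toℕ q < N ≤ (m + 1) k`, by `s ≤ k`,
  -- bounds the block index.
  start-index : ∀ {p q : Fin N} → toℕ q ≡ suc (toℕ p) → Start k q →
    ∃ λ i → suc i ≤ m × toℕ q ≡ suc i * k × toℕ p ≡ i * k + suc h
  start-index {p} {q} q≡1+p (divides zero q≡0) = contradiction (trans (sym q≡1+p) q≡0) λ ()
  start-index {p} {q} q≡1+p (divides (suc i) q≡) = i , s≤s⁻¹ 1+i<1+m , q≡ ,
    suc-injective (begin
      suc (toℕ p)          ≡⟨ q≡1+p ⟨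
      toℕ q                ≡⟨ q≡ ⟩
      k + i * k            ≡⟨ +-comm k (i * k) ⟩
      i * k + k            ≡⟨ +-suc (i * k) (suc h) ⟩
      suc (i * k + suc h)  ∎)
    where
    open ≡-Reasoning
    1+i<1+m : suc i < suc m
    1+i<1+m = *-cancelʳ-< k (suc i) (suc m) (<-≤-trans (subst (_< N) q≡ (Fin.toℕ<n q))
      (≤-trans (+-monoʳ-≤ (m * k) s≤k) (≤-reflexive (+-comm (m * k) k))))

  x-first : ∀ {i p} → toℕ p ≡ i * k → x (suc i) 1 p
  x-first p≡ = at z<s z<s z<s (trans p≡ (sym (+-identityʳ _)))

  x-first⁻¹ : ∀ {i p} → x (suc i) 1 p → toℕ p ≡ i * k
  x-first⁻¹ (at _ _ _ p≡) = trans p≡ (+-identityʳ _)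

  x-last : ∀ {i p} → toℕ p ≡ i * k + suc h → x (suc i) k p
  x-last p≡ = at z<s z<s ≤-refl p≡

  x-last⁻¹ : ∀ {i p} → x i k p → suc (toℕ p) ≡ i * k
  x-last⁻¹ {suc i} {p} (at _ _ _ p≡) = begin
    suc (toℕ p)          ≡⟨ cong suc p≡ ⟩
    suc (i * k + suc h)  ≡⟨ +-suc (i * k) (suc h) ⟨
    i * k + k            ≡⟨ +-comm (i * k) k ⟩
    suc i * k            ∎
    where open ≡-Reasoning

  x-penultimate : ∀ {i p} → toℕ p ≡ i * k + h → x (suc i) (suc h) p
  x-penultimate p≡ = at z<s z<s (n≤1+n _) p≡

  x-penultimate⁻¹ : ∀ {i p} → x i (suc h) p → suc (suc (toℕ p)) ≡ i * k
  x-penultimate⁻¹ {suc i} {p} (at _ _ _ p≡) = begin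
    suc (suc (toℕ p))      ≡⟨ cong (2 +_) p≡ ⟩
    suc (suc (i * k + h))  ≡⟨ +-comm 2 (i * k + h) ⟩
    i * k + h + 2          ≡⟨ +-assoc (i * k) h 2 ⟩
    i * k + (h + 2)        ≡⟨ cong (i * k +_) (+-comm h 2) ⟩
    i * k + k              ≡⟨ +-comm (i * k) k ⟩
    suc i * k              ∎
    where open ≡-Reasoning

  x-second : ∀ {i p} → toℕ p ≡ suc (i * k) → x (suc i) 2 p
  x-second p≡ = at z<s z<s (s≤s z<s) (trans p≡ (+-comm 1 _))

  x-second⁻¹ : ∀ {i p} → x (suc i) 2 p → toℕ p ≡ suc (i * k)
  x-second⁻¹ (at _ _ _ p≡) = trans p≡ (+-comm _ 1)

  -- The generators are exactly the pairs of adjacent positions: `within` gives the ascents inside a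
  -- block, `between` the descents across a boundary.
  block⇔ordered : ∀ {π} → Respects Block π ⇔ Ordered (Start k) π
  block⇔ordered {π} = mk⇔ to from
    where
    to : Respects Block π → Ordered (Start k) π
    to respects {p} {q} q≡1+p = descent , ascent
      where
      descent : Start k q → π ⟨$⟩ʳ q Fin.< π ⟨$⟩ʳ p
      descent k∣q with start-index {p} q≡1+p k∣q
      ... | i , i<m , q≡ , p≡ = respects (between i<m (x-first {suc i} q≡) (x-last p≡))

      ascent : ¬ Start k q → π ⟨$⟩ʳ p Fin.< π ⟨$⟩ʳ q
      -- Division with remainder locates `p` in its block; with remainder `k ∸ 1` the next position
      -- `q` would start a block.
      ascent k∤q =
        respects (within {suc (toℕ p / k)} (at z<s z<s (m%n<n (toℕ p) k) p≡) (at z<s z<s 1+r<k q≡))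
        where
        r = toℕ p % k
        p≡ : toℕ p ≡ toℕ p / k * k + r
        p≡ = trans (m≡m%n+[m/n]*n (toℕ p) k) (+-comm r _)
        q≡ : toℕ q ≡ toℕ p / k * k + suc r
        q≡ = trans q≡1+p (trans (cong suc p≡) (sym (+-suc _ r)))
        1+r<k : suc r < k
        1+r<k = ≤∧≢⇒< (m%n<n (toℕ p) k) λ 1+r≡k → k∤q (subst (k ∣_) (sym q≡)
          (∣m∣n⇒∣m+n (n∣m*n (toℕ p / k)) (∣-reflexive (sym 1+r≡k))))

    from : Ordered (Start k) π → Respects Block π
    from ordered (within {suc i} {suc a} (at _ _ _ p≡) (at _ _ 1+a<k q≡)) =
      proj₂ (ordered (trans q≡ (trans (+-suc _ a) (cong suc (sym p≡))))) λ k∣q →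
        >⇒∤ 1+a<k (∣m+n∣m⇒∣n (subst (k ∣_) q≡ k∣q) (n∣m*n i))
    from ordered (between {i} _ xp xq) =
      proj₁ (ordered (trans (x-first⁻¹ xp) (sym (x-last⁻¹ xq)))) (divides i (x-first⁻¹ xp))
    from ordered (within {zero} (at () _ _ _) _)
    from ordered (within {a = zero} (at _ () _ _) _)

  -- The extra relation compares the outer entries of the window `x_{i,k-1} x_{i,k} x_{i+1,1}`,
  -- whose second step is the descent.
  extra132⇔peak : ∀ {π} → Respects Extra132 π ⇔ Peak231 (Start k) π
  extra132⇔peak {π} = mk⇔ to from
    where
    to : Respects Extra132 π → Peak231 (Start k) π
    to respects {a} {b} {c} b≡1+a c≡1+b k∣c with start-index {b} c≡1+b k∣c
    ... | i , i<m , c≡ , b≡ = respects (extra i<m (x-first {suc i} c≡)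
      (x-penultimate (suc-injective (trans (sym b≡1+a) (trans b≡ (+-suc _ h))))))
    from : Peak231 (Start k) π → Respects Extra132 π
    from peak {c} {a} (extra {i} _ xc xa)
      with between-consecutive {a = a} {c} (trans (x-first⁻¹ xc) (sym (x-penultimate⁻¹ xa)))
    ... | b , b≡1+a , c≡1+b = peak {b = b} b≡1+a c≡1+b (divides i (x-first⁻¹ xc))

  -- Here the window is `x_{i,k} x_{i+1,1} x_{i+1,2}`, with the descent first. If `s` is 1, the last
  -- boundary has neither such a window nor an extra relation.
  extra213⇔valley : ∀ {π} → Respects Extra213 π ⇔ Valley312 (Start k) π
  extra213⇔valley {π} = mk⇔ to from
    where
    to : Respects Extra213 π → Valley312 (Start k) π
    to respects {a} {b} {c} b≡1+a c≡1+b k∣b with start-index {a} b≡1+a k∣b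
    ... | i , i<m , b≡ , a≡ =
      respects (extra i<m (x-second {suc i} (trans c≡1+b (cong suc b≡))) (x-last a≡))
    from : Valley312 (Start k) π → Respects Extra213 π
    from valley {c} {a} (extra {i} _ xc xa)
      with between-consecutive {a = a} {c} (trans (x-second⁻¹ xc) (cong suc (sym (x-last⁻¹ xa))))
    ... | b , b≡1+a , c≡1+b = valley {b = b} b≡1+a c≡1+b
      (divides i (suc-injective (trans (sym c≡1+b) (x-second⁻¹ xc))))

  linearExtension≐ : ∀ {T : Pred (Permutation′ N) 0ℓ} R (mono : R =[ rank ]⇒ _<_) →
    (∀ {π} → Respects R π ⇔ T π) →
    Ordered (Start k) ∩ T ≐ LinearExtension (addRelations R mono)
  -- The values of π serve as the rank function in closure-mono.
  linearExtension≐ {T} R mono R⇔T = to , from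
    where
    to : ∀ {π} → (Ordered (Start k) ∩ T) π → LinearExtension (addRelations R mono) π
    to {π} (ordered , t) = closure-mono _ (λ p → toℕ (π ⟨$⟩ʳ p)) λ
      { (inj₁ r) → closure-mono Block (λ p → toℕ (π ⟨$⟩ʳ p))
          (Equivalence.from (block⇔ordered {π}) ordered) r
      ; (inj₂ r) → Equivalence.from R⇔T t r }
    from : ∀ {π} → LinearExtension (addRelations R mono) π → (Ordered (Start k) ∩ T) π
    from {π} le =
      Equivalence.to (block⇔ordered {π}) (λ r → le [ inj₁ [ r ] ]) ,
      Equivalence.to R⇔T (λ r → le [ inj₂ r ])

  peak≐P132 : Ordered (Start k) ∩ Peak231 (Start k) ≐ LinearExtension P132
  peak≐P132 = linearExtension≐ Extra132 (λ { (extra i≤m xp xq) → rank-later-block i≤m xp xq })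
    λ {π} → extra132⇔peak {π}

  valley≐P213 : Ordered (Start k) ∩ Valley312 (Start k) ≐ LinearExtension P213
  valley≐P213 = linearExtension≐ Extra213 (λ { (extra i≤m xp xq) → rank-later-block i≤m xp xq })
    λ {π} → extra213⇔valley {π}

𝒟[]≐ : ∀ {N k} .{{_ : NonZero k}} p {T : Pred (Permutation′ N) 0ℓ} →
  (∀ {π} → Ordered (Start k) π → Avoids p π ⇔ T π) → 𝒟[ p ] N k ≐ Ordered (Start k) ∩ T
𝒟[]≐ p {T} avoids⇔ =
  (λ {π} (d , avoids) → let ordered = proj₁ 𝒟≐Ordered {π} d in
    ordered , Equivalence.to (avoids⇔ {π} ordered) avoids) ,
  (λ {π} (ordered , t) → proj₂ 𝒟≐Ordered {π} ordered , Equivalence.from (avoids⇔ {π} ordered) t)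

-- Both classes consist of the permutations in `T`, so the identity relates them: a permutation, as
-- map from positions to values, is itself the linear extension. Decidability of `T` provides the
-- common size.
≃#-via : ∀ {N} {T P Q : Pred (Permutation′ N) 0ℓ} → Decidable T → OrderInvariant T →
  T ≐ P → T ≐ Q → ⟦ P ⟧ ≃# ⟦ Q ⟧
≃#-via {T = T} T? T-inv T≐P T≐Q = let (c , T↔) = decidable-size T? (≈-resp {T = T} T-inv) in
  c , ⟦⟧-cong T≐P T↔ , ⟦⟧-cong T≐Q T↔

-- Counting by removal of the first entry.

remove-reflects-< : ∀ {n} (π : Permutation′ (suc n)) {i j} →
  remove zero π ⟨$⟩ʳ i Fin.< remove zero π ⟨$⟩ʳ j → π ⟨$⟩ʳ suc i Fin.< π ⟨$⟩ʳ suc j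
remove-reflects-< π {i} {j} i<j = ≰⇒> λ πj≤πi → <⇒≱ i<j (Fin.punchIn-cancel-≤ (π ⟨$⟩ʳ zero) _ _
  (subst₂ Fin._≤_ (punchIn-permute π zero j) (punchIn-permute π zero i) πj≤πi))

remove-preserves-< : ∀ {n} (π : Permutation′ (suc n)) {i j} →
  π ⟨$⟩ʳ suc i Fin.< π ⟨$⟩ʳ suc j → remove zero π ⟨$⟩ʳ i Fin.< remove zero π ⟨$⟩ʳ j
remove-preserves-< π {i} {j} i<j = ≰⇒> λ j≤i → <⇒≱ i<j
  (subst₂ Fin._≤_ (sym (punchIn-permute π zero j)) (sym (punchIn-permute π zero i))
    (Fin.punchIn-mono-≤ (π ⟨$⟩ʳ zero) _ _ j≤i))

>⇒suc : ∀ {n} {i j : Fin (suc n)} → i Fin.< j → ∃ λ v → j ≡ suc v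
>⇒suc {j = suc v} _ = v , refl

FromEnd : ∀ {n} → Pred ℕ 0ℓ → Pred (Fin n) 0ℓ
FromEnd {n} E q = E (n ∸ toℕ q)

-- The block structure is recorded by the set E of the numbers of entries, from
-- the first entry of a block to the end, which is unchanged when the first
-- entry of the permutation is removed.
module Count (E : Pred ℕ 0ℓ) (E? : Decidable E)
  (¬E0 : ¬ E 0) (sparse : ∀ {r} → E r → ¬ E (suc r))
  where

  Good : ∀ {n} → Pred (Permutation′ n) 0ℓ
  Good = Ordered (FromEnd E) ∩ Peak132 (FromEnd E)

  good-resp : ∀ {n} {π ρ : Permutation′ n} → π ≈ ρ → Good π → Good ρ
  good-resp {n} {π} {ρ} = ≈-resp {T = Good {n}}
    (∩-invariant (ordered-invariant (FromEnd E)) (peak132-invariant (FromEnd E))) {π} {ρ}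

  -- Since `suc n ∸ suc i` reduces to `n ∸ i`, the block starts of the remainder are those of `π`,
  -- and the conditions simply restrict.
  good-remove : ∀ {n} (π : Permutation′ (suc n)) → Good π → Good (remove zero π)
  good-remove π (ordered , peak) =
    (λ q≡1+p → remove-preserves-< π ∘ proj₁ (ordered (cong suc q≡1+p)) ,
               remove-preserves-< π ∘ proj₂ (ordered (cong suc q≡1+p))) ,
    λ b≡1+a c≡1+b → remove-preserves-< π ∘ peak (cong suc b≡1+a) (cong suc c≡1+b)

  -- Only the first step and the first window involve the new entry. `E n` says that the second
  -- entry starts a block, `E (n ∸ 1)` that the third does.
  good-cons : ∀ {n} (π : Permutation′ (suc n)) → Good (remove zero π) →
    (∀ {q} → toℕ q ≡ 0 →
      (E n → π ⟨$⟩ʳ suc q Fin.< π ⟨$⟩ʳ zero) × (¬ E n → π ⟨$⟩ʳ zero Fin.< π ⟨$⟩ʳ suc q)) →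
    (∀ {c} → toℕ c ≡ 1 → E (n ∸ 1) → π ⟨$⟩ʳ zero Fin.< π ⟨$⟩ʳ suc c) →
    Good π
  good-cons {n} π (ordered , peak) ordered₀ peak₀ =
    (λ {p} {q} → ordered′ {p} {q}) , λ {a} {b} {c} → peak′ {a} {b} {c}
    where
    ordered′ : Ordered (FromEnd E) π
    ordered′ {zero}  {suc q} q≡1+p with suc-injective q≡1+p
    ... | q≡0 = proj₁ (ordered₀ q≡0) ∘ subst (λ i → E (n ∸ i)) q≡0 ,
                λ ¬E → proj₂ (ordered₀ q≡0) (¬E ∘ subst (λ i → E (n ∸ i)) (sym q≡0))
    ordered′ {suc p} {suc q} q≡1+p =
      remove-reflects-< π ∘ proj₁ (ordered (suc-injective q≡1+p)) ,
      remove-reflects-< π ∘ proj₂ (ordered (suc-injective q≡1+p))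
    peak′ : Peak132 (FromEnd E) π
    peak′ {zero}  {suc b} {suc c} b≡1+a c≡1+b Ec with trans (suc-injective c≡1+b) b≡1+a
    ... | c≡1 = peak₀ c≡1 (subst (λ i → E (n ∸ i)) c≡1 Ec)
    peak′ {suc a} {suc b} {suc c} b≡1+a c≡1+b =
      remove-reflects-< π ∘ peak (suc-injective b≡1+a) (suc-injective c≡1+b)

  -- The first step ascends. If the third entry starts no block, the second is least among the rest
  -- by induction. If it does, avoiding 231 puts the first entry below the third, and the third is
  -- least from there on, because by sparseness the fourth starts no block.
  first-least : ∀ {n} (π : Permutation′ (suc n)) → Good π → ¬ E n →
    ∀ j → π ⟨$⟩ʳ zero Fin.< π ⟨$⟩ʳ suc j
  first-least π (ordered , _) ¬E zero = proj₂ (ordered refl) ¬E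
  first-least {suc (suc n)} π good@(ordered , peak) ¬E (suc j) with E? (suc n)
  ... | no ¬E′ = <-trans (proj₂ (ordered refl) ¬E)
    (remove-reflects-< π (first-least (remove zero π) (good-remove π good) ¬E′ j))
  ... | yes E′ = third j
    where
    π′ = remove zero π
    first<third : π ⟨$⟩ʳ 0F Fin.< π ⟨$⟩ʳ 2F
    first<third = peak {b = 1F} refl refl E′
    third : ∀ j → π ⟨$⟩ʳ 0F Fin.< π ⟨$⟩ʳ suc (suc j)
    third zero = first<third
    third (suc j) = <-trans first<third (remove-reflects-< π (remove-reflects-< π′
      (first-least (remove zero π′) (good-remove π′ (good-remove π good)) (λ E″ → sparse E″ E′) j)))

  first-zero : ∀ {n} (π : Permutation′ (suc n)) → Good π → ¬ E n → π ⟨$⟩ʳ zero ≡ zero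
  first-zero π good ¬E with π ⟨$⟩ˡ zero in eq
  ... | zero  = preimage π eq
  ... | suc j = contradiction
    (subst (π ⟨$⟩ʳ zero Fin.<_) (preimage π eq) (first-least π good ¬E j)) n≮0

  -- The second entry is the least of the remainder, so the value 0 sits in first or second place.
  second<first : ∀ {n} (π : Permutation′ (suc (suc n))) → Good (remove zero π) → ¬ E n →
    π ⟨$⟩ʳ 0F ≢ zero → π ⟨$⟩ʳ 1F Fin.< π ⟨$⟩ʳ 0F
  second<first π good ¬E π₀≢0 with π ⟨$⟩ˡ zero in eq
  ... | zero        = contradiction (preimage π eq) π₀≢0
  ... | suc zero    = subst (Fin._< π ⟨$⟩ʳ 0F) (sym (preimage π eq))
    (n≢0⇒n>0 (π₀≢0 ∘ Fin.toℕ-injective))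
  ... | suc (suc j) = contradiction (subst (π ⟨$⟩ʳ 1F Fin.<_) (preimage π eq)
    (remove-reflects-< π (first-least (remove zero π) good ¬E j))) n≮0

  -- The number of admissible first values in front of `n` further entries.
  choices : ∀ n → Dec (E n) → ℕ
  choices n (yes _) = n
  choices n (no _)  = 1

  count : ℕ → ℕ
  count zero    = 1
  count (suc n) = choices n (E? n) * count n

  good-size : ∀ n → ⟦ Good {n} ⟧ HasSize (count n)
  good-size zero = ⟦⟧-cong ((λ _ → (λ { {()} }) , λ { {()} }) , _) (permutations-size 0)
  good-size (suc n) with E? n
  good-size (suc zero)    | yes E0 = contradiction E0 ¬E0
  -- The second entry starts a block: the first value may be anything but the least, and `suc`
  -- enumerates these values.
  good-size (suc (suc n)) | yes E′ = ⟦⟧-remove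
    (λ {π} {ρ} → good-resp {π = π} {ρ}) suc Fin.suc-injective
    (λ {π} → split {π}) (λ {π} → join {π}) (good-size (suc n))
    where
    split : ∀ {π : Permutation′ (suc (suc n))} → Good π →
      (∃ λ v → π ⟨$⟩ʳ zero ≡ suc v) × Good (remove zero π)
    split {π} good = >⇒suc (proj₁ (proj₁ good {0F} {1F} refl) E′) , good-remove π good
    join : ∀ {π : Permutation′ (suc (suc n))} →
      (∃ λ v → π ⟨$⟩ʳ zero ≡ suc v) → Good (remove zero π) → Good π
    join {π} (v , π₀≡) good = good-cons π good
      (λ q≡0 → (λ _ → descent q≡0) , contradiction E′) λ _ E″ → contradiction E′ (sparse E″)
      where
      descent : ∀ {q : Fin (suc n)} → toℕ q ≡ 0 → π ⟨$⟩ʳ suc q Fin.< π ⟨$⟩ʳ zero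
      descent {zero} _ = second<first π good (λ E″ → sparse E″ E′) λ π₀≡0 →
        Fin.0≢1+n (trans (sym π₀≡0) π₀≡)
  -- No descent follows, so the first value is forced to be `zero`.
  good-size (suc n) | no ¬E = ⟦⟧-remove
    (λ {π} {ρ} → good-resp {π = π} {ρ}) (λ (_ : Fin 1) → zero) (λ { {zero} {zero} _ → refl })
    (λ {π} → split {π}) (λ {π} → join {π}) (good-size n)
    where
    split : ∀ {π : Permutation′ (suc n)} → Good π →
      (∃ λ (_ : Fin 1) → π ⟨$⟩ʳ zero ≡ zero) × Good (remove zero π)
    split {π} good = (zero , first-zero π good ¬E) , good-remove π good
    join : ∀ {π : Permutation′ (suc n)} →
      (∃ λ (_ : Fin 1) → π ⟨$⟩ʳ zero ≡ zero) → Good (remove zero π) → Good π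
    join {π} (_ , π₀≡0) good = good-cons π good
      (λ _ → (λ E′ → contradiction E′ ¬E) , λ _ → first< _) (λ _ _ → first< _)
      where
      first< : ∀ j → π ⟨$⟩ʳ zero Fin.< π ⟨$⟩ʳ suc j
      first< j = subst (Fin._< π ⟨$⟩ʳ suc j) (sym π₀≡0) (n≢0⇒n>0 λ πⱼ≡0 →
        Fin.0≢1+n (injective π (trans π₀≡0 (sym (Fin.toℕ-injective πⱼ≡0)))))

  count-flat : ∀ a i → (∀ {n} → a ≤ n → n < a + i → ¬ E n) → count (a + i) ≡ count a
  count-flat a zero    _  = cong count (+-identityʳ a)
  count-flat a (suc i) ¬E rewrite +-suc a i with E? (a + i)
  ... | yes E′ = contradiction E′ (¬E (m≤m+n a i) ≤-refl)
  ... | no _   = trans (+-identityʳ _) (count-flat a i λ a≤n n<a+i → ¬E a≤n (<-trans n<a+i ≤-refl))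

  count-jump : ∀ a i → E a → (∀ {n} → suc a ≤ n → n < suc a + i → ¬ E n) →
    count (suc a + i) ≡ a * count a
  count-jump a i Ea ¬E = trans (count-flat (suc a) i ¬E) jump
    where
    jump : count (suc a) ≡ a * count a
    jump with E? a
    ... | yes _  = refl
    ... | no ¬Ea = contradiction Ea ¬Ea

-- Reverse-complement.

reverse-complement : ∀ {n} → Permutation′ n → Permutation′ n
reverse-complement π = reverse ∘ₚ π ∘ₚ reverse

reverse-complement-cong : ∀ {n} {π ρ : Permutation′ n} → π ≈ ρ →
  reverse-complement π ≈ reverse-complement ρ
reverse-complement-cong π≈ρ i = cong opposite (π≈ρ (opposite i))

reverse-complement-involutive : ∀ {n} (π : Permutation′ n) →
  reverse-complement (reverse-complement π) ≈ π
reverse-complement-involutive π i =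
  trans (Fin.opposite-involutive _) (cong (π ⟨$⟩ʳ_) (Fin.opposite-involutive i))

opposite-anti-< : ∀ {n} {i j : Fin n} → i Fin.< j → opposite j Fin.< opposite i
opposite-anti-< {n} {i} {j} i<j = subst₂ _<_ (sym (Fin.opposite-prop j)) (sym (Fin.opposite-prop i))
  (∸-monoʳ-< (s≤s i<j) (Fin.toℕ<n j))

opposite-consecutive : ∀ {n} {p q : Fin n} → toℕ q ≡ suc (toℕ p) →
  toℕ (opposite p) ≡ suc (toℕ (opposite q))
opposite-consecutive {n} {p} {q} q≡1+p = begin
  toℕ (opposite p)        ≡⟨ Fin.opposite-prop p ⟩
  n ∸ suc (toℕ p)         ≡⟨ cong (n ∸_) q≡1+p ⟨
  n ∸ toℕ q               ≡⟨ +-∸-assoc 1 (Fin.toℕ<n q) ⟩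
  suc (n ∸ suc (toℕ q))   ≡⟨ cong suc (Fin.opposite-prop q) ⟨
  suc (toℕ (opposite q))  ∎
  where open ≡-Reasoning

module _ {n : ℕ} {D D′ : Pred (Fin n) 0ℓ} (π : Permutation′ n)
  (D⇔D′ : ∀ {p q} → toℕ q ≡ suc (toℕ p) → D (opposite p) ⇔ D′ q) where

  -- Mirroring turns the step from `p` to `q` into one that ends at `opposite p`. Hence `D⇔D′`
  -- matches ends of steps, and does not reflect `D` position by position.
  reverse-complement-ordered : Ordered D π → Ordered D′ (reverse-complement π)
  reverse-complement-ordered ordered {p} {q} q≡1+p =
    (λ D′q → opposite-anti-< (proj₁ comparison (Equivalence.from (D⇔D′ q≡1+p) D′q))) ,
    λ ¬D′q → opposite-anti-< (proj₂ comparison (¬D′q ∘ Equivalence.to (D⇔D′ q≡1+p)))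
    where comparison = ordered (opposite-consecutive {p = p} {q} q≡1+p)

  reverse-complement-valley : Valley213 D π → Peak132 D′ (reverse-complement π)
  reverse-complement-valley valley {a} {b} {c} b≡1+a c≡1+b D′c = opposite-anti-<
    (valley (opposite-consecutive {p = b} {c} c≡1+b) (opposite-consecutive {p = a} {b} b≡1+a)
      (Equivalence.from (D⇔D′ c≡1+b) D′c))

  reverse-complement-peak : Peak132 D π → Valley213 D′ (reverse-complement π)
  reverse-complement-peak peak {a} {b} {c} b≡1+a c≡1+b D′b = opposite-anti-<
    (peak (opposite-consecutive {p = b} {c} c≡1+b) (opposite-consecutive {p = a} {b} b≡1+a)
      (Equivalence.from (D⇔D′ b≡1+a) D′b))

-- Evaluation of the count for blocks of length `k`.

module Periodic (k t : ℕ) .{{_ : NonZero k}} (2≤k : 2 ≤ k) where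

  -- Measured from the end, the starts of non-initial blocks form one residue class modulo `k`. The
  -- shift `t` is `k ∸ s` when the block of length `s` comes last, and 0 when mirroring has moved it
  -- to the front; `0 < r` excludes the empty remainder.
  Cut : Pred ℕ 0ℓ
  Cut r = 0 < r × k ∣ r + t

  cut-sparse : ∀ {r} → Cut r → ¬ Cut (suc r)
  cut-sparse (_ , k∣r+t) (_ , k∣1+r+t) = ∣-sparse 2≤k k∣r+t k∣1+r+t

  open Count Cut (λ r → (0 <? r) ×-dec (k ∣? r + t)) (λ (0<0 , _) → n≮0 0<0) cut-sparse public

  no-cut-between : ∀ {a n} → k ∣ a + t → suc a ≤ n → n < a + k → ¬ Cut n
  no-cut-between {a} {n} k∣a+t a<n n<a+k (_ , k∣n+t) =
    >⇒∤ (m<n+o⇒m∸n<o n a n<a+k) (∣m+n∣m⇒∣n (subst (k ∣_) n+t≡ k∣n+t) k∣a+t)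
    where
    instance
      n∸a-nonZero : NonZero (n ∸ a)
      n∸a-nonZero = >-nonZero (m<n⇒0<n∸m a<n)
    open ≡-Reasoning
    n+t≡ : n + t ≡ a + t + (n ∸ a)
    n+t≡ = begin
      n + t              ≡⟨ cong (_+ t) (m+[n∸m]≡n (<⇒≤ a<n)) ⟨
      a + (n ∸ a) + t    ≡⟨ +-assoc a (n ∸ a) t ⟩
      a + ((n ∸ a) + t)  ≡⟨ cong (a +_) (+-comm (n ∸ a) t) ⟩
      a + (t + (n ∸ a))  ≡⟨ +-assoc a t (n ∸ a) ⟨
      a + t + (n ∸ a)    ∎

  count-first : ∀ s → s + t ≤ k → count s ≡ 1
  count-first s s+t≤k = count-flat 0 s λ { {n} _ n<s (0<n , k∣n+t) →
    >⇒∤ {{>-nonZero (<-≤-trans 0<n (m≤m+n n t))}} (<-≤-trans (+-monoˡ-< t n<s) s+t≤k) k∣n+t }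

  count-block : ∀ a s → Cut a → 1 ≤ s → s ≤ k → count (a + s) ≡ a * count a
  count-block a (suc i) cut@(_ , k∣a+t) _ 1+i≤k = trans (cong count (+-suc a i))
    (count-jump a i cut λ a<n n<1+a+i → no-cut-between k∣a+t a<n
      (<-≤-trans n<1+a+i (≤-trans (≤-reflexive (sym (+-suc a i))) (+-monoʳ-≤ a 1+i≤k))))

module _ (k : ℕ) .{{_ : NonZero k}} (2≤k : 2 ≤ k) where

  private
    0<k : 0 < k
    0<k = <⇒≤ 2≤k

  -- The cuts are `k`, `2k`, ..., `mk`, and their product is `k ^ m * m !`.
  count-312 : ∀ m s → 1 ≤ s → s ≤ k → Periodic.count k 0 2≤k (m * k + s) ≡ k ^ m * m !
  count-312 zero    s 1≤s s≤k =
    Periodic.count-first k 0 2≤k s (≤-trans (≤-reflexive (+-identityʳ s)) s≤k)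
  count-312 (suc m) s 1≤s s≤k = begin
    count (suc m * k + s)          ≡⟨ count-block (suc m * k) s cut 1≤s s≤k ⟩
    suc m * k * count (suc m * k)  ≡⟨ cong (λ a → suc m * k * count a) (+-comm k (m * k)) ⟩
    -- Below the largest cut the initial block is full, so the induction hypothesis is taken at
    -- `s = k`.
    suc m * k * count (m * k + k)  ≡⟨ cong (suc m * k *_) (count-312 m k 0<k ≤-refl) ⟩
    suc m * k * (k ^ m * m !)
      ≡⟨ solve 4 (λ a b c d → a :* b :* (c :* d) := b :* c :* (a :* d)) refl (suc m) k (k ^ m) (m !) ⟩
    k * k ^ m * (suc m * m !)      ∎
    where
    open Periodic k 0 2≤k
    open ≡-Reasoning
    cut : Cut (suc m * k)
    cut = m≤n⇒m≤n+o (m * k) 0<k , ∣m∣n⇒∣m+n (n∣m*n (suc m)) (k ∣0)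

  -- The cuts are `s + j * k` for `j < m`. The shift depends on `s`, so `s` stays fixed in the
  -- induction and a full initial block is split off.
  count-231 : ∀ m s → 1 ≤ s → s ≤ k →
    Periodic.count k (k ∸ s) 2≤k (m * k + s) ≡ product (applyUpTo (λ j → s + j * k) m)
  count-231 zero    s 1≤s s≤k = Periodic.count-first k (k ∸ s) 2≤k s (≤-reflexive (m+[n∸m]≡n s≤k))
  count-231 (suc m) s 1≤s s≤k = begin
    count (suc m * k + s)
      ≡⟨ cong count (solve 3 (λ k a s → k :+ a :+ s := a :+ s :+ k) refl k (m * k) s) ⟩
    count (m * k + s + k)
      ≡⟨ count-block (m * k + s) k (≤-trans 1≤s (m≤n+m s (m * k)) , k∣) 0<k ≤-refl ⟩
    (m * k + s) * count (m * k + s)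
      ≡⟨ cong ((m * k + s) *_) (count-231 m s 1≤s s≤k) ⟩
    (m * k + s) * product (applyUpTo f m)
      ≡⟨ solve 3 (λ a s p → (a :+ s) :* p := p :* ((s :+ a) :* con 1)) refl (m * k) s _ ⟩
    product (applyUpTo f m) * product (f m ∷ [])
      -- The induction contributes the last factor, whereas `applyUpTo` unfolds from the first.
      ≡⟨ product-++ (applyUpTo f m) (f m ∷ []) ⟨
    product (applyUpTo f m ∷ʳ f m)
      ≡⟨ cong product (applyUpTo-∷ʳ f m) ⟩
    product (applyUpTo f (suc m))
      ∎
    where
    open Periodic k (k ∸ s) 2≤k
    open ≡-Reasoning
    f : ℕ → ℕ
    f j = s + j * k
    k∣ : k ∣ m * k + s + (k ∸ s)
    k∣ = subst (k ∣_) (sym (trans (+-assoc (m * k) s (k ∸ s)) (cong (m * k +_) (m+[n∸m]≡n s≤k))))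
      (∣m∣n⇒∣m+n (n∣m*n m) ∣-refl)

-- The six avoidance classes.

module StandardBlocks (k m s : ℕ) .{{_ : NonZero k}} (2≤k : 2 ≤ k) (1≤s : 1 ≤ s) (s≤k : s ≤ k) where

  N : ℕ
  N = m * k + s

  sparse-starts : ∀ {p q : Fin N} → toℕ q ≡ suc (toℕ p) → Start k p → ¬ Start k q
  sparse-starts {p} {q} = start-sparse 2≤k {p} {q}

  231-size : ⟦ 𝒟[ p231 ] N k ⟧ HasSize product (applyUpTo (λ j → s + j * k) m)
  231-size = subst (⟦ 𝒟[ p231 ] N k ⟧ HasSize_) (count-231 k 2≤k m s 1≤s s≤k)
    (⟦⟧-cong (≐-sym (𝒟[]≐ p231 {Peak132 (Start k)} λ {π} → avoids-231⇔ (start? k) sparse-starts {π}))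
      (⟦⟧-cong {Q = Ordered (Start k) ∩ Peak132 (Start k)}
        ((λ {π} → from {π}) , λ {π} → to {π}) (good-size N)))
    where
    open Periodic k (k ∸ s) 2≤k
    -- Padding the last block by `k ∸ s` entries makes the total length a multiple of `k`, so
    -- divisibility from the left and from the right agree.
    start⇔cut : ∀ {q : Fin N} → Start k q ⇔ FromEnd Cut q
    start⇔cut {q} = mk⇔
      (λ k∣q → m<n⇒0<n∸m (Fin.toℕ<n q) , ∣m+n∣m⇒∣n k∣total k∣q)
      λ (_ , k∣rest) → ∣m+n∣m⇒∣n (subst (k ∣_) (+-comm (toℕ q) _) k∣total) k∣rest
      where
      open ≡-Reasoning
      total≡ : toℕ q + (N ∸ toℕ q + (k ∸ s)) ≡ m * k + k
      total≡ = begin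
        toℕ q + (N ∸ toℕ q + (k ∸ s))  ≡⟨ +-assoc (toℕ q) (N ∸ toℕ q) (k ∸ s) ⟨
        toℕ q + (N ∸ toℕ q) + (k ∸ s)  ≡⟨ cong (_+ (k ∸ s)) (m+[n∸m]≡n (<⇒≤ (Fin.toℕ<n q))) ⟩
        m * k + s + (k ∸ s)            ≡⟨ +-assoc (m * k) s (k ∸ s) ⟩
        m * k + (s + (k ∸ s))          ≡⟨ cong (m * k +_) (m+[n∸m]≡n s≤k) ⟩
        m * k + k                      ∎
      k∣total : k ∣ toℕ q + (N ∸ toℕ q + (k ∸ s))
      k∣total = subst (k ∣_) (sym total≡) (∣m∣n⇒∣m+n (n∣m*n m) ∣-refl)

    to : ∀ {π} → (Ordered (Start k) ∩ Peak132 (Start k)) π → Good π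
    to {π} (ordered , peak) =
      (λ {p} {q} q≡1+p → proj₁ (ordered q≡1+p) ∘ Equivalence.from (start⇔cut {q})
                       , λ ¬c → proj₂ (ordered q≡1+p) (¬c ∘ Equivalence.to (start⇔cut {q}))) ,
      λ {a} {b} {c} b≡1+a c≡1+b → peak {b = b} b≡1+a c≡1+b ∘ Equivalence.from (start⇔cut {c})
    from : ∀ {π} → Good π → (Ordered (Start k) ∩ Peak132 (Start k)) π
    from {π} (ordered , peak) =
      (λ {p} {q} q≡1+p → proj₁ (ordered q≡1+p) ∘ Equivalence.to (start⇔cut {q})
                       , λ ¬c → proj₂ (ordered q≡1+p) (¬c ∘ Equivalence.from (start⇔cut {q}))) ,
      λ {a} {b} {c} b≡1+a c≡1+b → peak {b = b} b≡1+a c≡1+b ∘ Equivalence.to (start⇔cut {c})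

  312-size : ⟦ 𝒟[ p312 ] N k ⟧ HasSize (k ^ m * m !)
  312-size = subst (⟦ 𝒟[ p312 ] N k ⟧ HasSize_) (count-312 k 2≤k m s 1≤s s≤k)
    (⟦⟧-cong (≐-sym (𝒟[]≐ p312 {Valley213 (Start k)} λ {π} → avoids-312⇔ (start? k) sparse-starts {π}))
      (⟦⟧-transport reverse-complement (λ {π} {ρ} → reverse-complement-cong {π = π} {ρ})
        reverse-complement-involutive (λ {π} → from {π}) (λ {π} → to {π}) (good-size N)))
    where
    open Periodic k 0 2≤k
    -- Exactly `toℕ q` entries run from `opposite p` to the end, so the shift is 0.
    cut⇔start : ∀ {p q : Fin N} → toℕ q ≡ suc (toℕ p) → FromEnd Cut (opposite p) ⇔ Start k q
    cut⇔start {p} {q} q≡1+p = mk⇔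
      (λ (_ , k∣) → subst (k ∣_) (trans (+-identityʳ _) from-end) k∣)
      λ k∣q → subst (0 <_) (sym (trans from-end q≡1+p)) z<s ,
              subst (k ∣_) (sym (trans (+-identityʳ _) from-end)) k∣q
      where
      from-end : N ∸ toℕ (opposite p) ≡ toℕ q
      from-end = trans (cong (N ∸_) (Fin.opposite-prop p))
        (trans (m∸[m∸n]≡n (Fin.toℕ<n p)) (sym q≡1+p))
    start⇔cut : ∀ {p q : Fin N} → toℕ q ≡ suc (toℕ p) → Start k (opposite p) ⇔ FromEnd Cut q
    start⇔cut {p} {q} q≡1+p = mk⇔
      (λ k∣ → m<n⇒0<n∸m (Fin.toℕ<n q) , subst (k ∣_) (trans position (sym (+-identityʳ _))) k∣)
      λ (_ , k∣) → subst (k ∣_) (sym (trans position (sym (+-identityʳ _)))) k∣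
      where
      position : toℕ (opposite p) ≡ N ∸ toℕ q
      position = trans (Fin.opposite-prop p) (cong (N ∸_) (sym q≡1+p))

    to : ∀ {π} → (Ordered (Start k) ∩ Valley213 (Start k)) π → Good (reverse-complement π)
    to {π} (ordered , valley) =
      reverse-complement-ordered π start⇔cut ordered , reverse-complement-valley π start⇔cut valley
    from : ∀ {π} → Good π → (Ordered (Start k) ∩ Valley213 (Start k)) (reverse-complement π)
    from {π} (ordered , peak) =
      reverse-complement-ordered π cut⇔start ordered , reverse-complement-peak π cut⇔start peak

  ∩-dec : {T : Pred (Permutation′ N) 0ℓ} → Decidable T → Decidable (Ordered (Start k) ∩ T)
  ∩-dec T? π = ordered? (start? k) π ×-dec T? π

  321-size : ⟦ 𝒟[ p321 ] N k ⟧ ≃# ⟦ 𝒟 N k ⟧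
  321-size = ≃#-via (ordered? (start? k)) (ordered-invariant (Start k))
    ((λ {π} ordered → proj₂ 𝒟≐Ordered {π} ordered , avoids-321 {π = π} sparse-starts ordered) ,
     λ {π} (d , _) → proj₁ 𝒟≐Ordered {π} d)
    (≐-sym 𝒟≐Ordered)

  -- For `N < 3` there is no window; for `k ≡ 2` one of any two adjacent positions is even and so a
  -- block start.
  123-all : N < 3 ⊎ k ≡ 2 → 𝒟[ p123 ] N k ≐ 𝒟 N k
  123-all small = proj₁ , λ {π} d → d ,
    avoids-123 {π = π} sparse-starts (proj₁ 𝒟≐Ordered {π} d) (dense small)
    where
    dense : N < 3 ⊎ k ≡ 2 → Triples {N} λ a b c → ¬ Start k b → ¬ ¬ Start k c
    dense (inj₁ N<3) {c = c} b≡1+a c≡1+b _ _ =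
      <⇒≱ N<3 (<-≤-trans (s≤s (subst (2 ≤_) (sym (trans c≡1+b (cong suc b≡1+a))) (s≤s (s≤s z≤n))))
        (Fin.toℕ<n c))
    dense (inj₂ refl) {b = b} _ c≡1+b 2∤b 2∤c =
      2∤c (subst (2 ∣_) (sym c≡1+b) (2∤⇒2∣suc (toℕ b) 2∤b))

  -- The first three positions lie in the first block and form a 123.
  123-empty : 3 ≤ k → 3 ≤ N → ⟦ 𝒟[ p123 ] N k ⟧ HasSize 0
  123-empty 3≤k 3≤N = empty-size λ π (d , avoids) →
    let ordered = proj₁ 𝒟≐Ordered {π} d in
    avoids (contains π p123 {position 0F} {position 1F} {position 2F}
      (consecutive 0F 1F refl) (consecutive 1F 2F refl)
      ( proj₂ (ordered (consecutive 0F 1F refl)) (not-start 1F z<s)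
      , proj₂ (ordered (consecutive 1F 2F refl)) (not-start 2F z<s)))
    where
    position : Fin 3 → Fin N
    position i = Fin.inject≤ i 3≤N
    consecutive : ∀ i j → toℕ j ≡ suc (toℕ i) → toℕ (position j) ≡ suc (toℕ (position i))
    consecutive i j j≡1+i = trans (Fin.toℕ-inject≤ j 3≤N)
      (trans j≡1+i (cong suc (sym (Fin.toℕ-inject≤ i 3≤N))))
    not-start : ∀ i → 0 < toℕ i → ¬ Start k (position i)
    not-start i 0<i k∣i = >⇒∤ {{>-nonZero 0<i}} (<-≤-trans (Fin.toℕ<n i) 3≤k)
      (subst (k ∣_) (Fin.toℕ-inject≤ i 3≤N) k∣i)

theorem4p1 : (k m s : ℕ) .{{_ : NonZero k}} → 2 ≤ k → 1 ≤ s → s ≤ k →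
    let N = m * k + s in
    ((3 ≤ k → 3 ≤ N → ⟦ 𝒟[ p123 ] N k ⟧ HasSize 0) × (N < 3 ⊎ k ≡ 2 → 𝒟[ p123 ] N k ≐ 𝒟 N k)) ×
    (⟦ 𝒟[ p321 ] N k ⟧ ≃# ⟦ 𝒟 N k ⟧) ×
    (⟦ 𝒟[ p312 ] N k ⟧ HasSize (k ^ m * m !)) ×
    (⟦ 𝒟[ p231 ] N k ⟧ HasSize product (applyUpTo (λ j → s + j * k) m)) ×
    (⟦ 𝒟[ p132 ] N k ⟧ ≃# LinearExtensions (Blocks.P132 m s k)) ×
    (⟦ 𝒟[ p213 ] N k ⟧ ≃# LinearExtensions (Blocks.P213 m s k))
theorem4p1 zero m s ()
theorem4p1 (suc zero) m s (s≤s ())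
theorem4p1 k@(suc (suc h)) m s 2≤k 1≤s s≤k =
  (123-empty , 123-all) , 321-size , 312-size , 231-size ,
  ≃#-via (∩-dec λ π → triples? λ a b c → start? k c →-dec (_ Fin.<? _))
    (∩-invariant (ordered-invariant (Start k)) (peak231-invariant (Start k)))
    (≐-sym (𝒟[]≐ p132 {Peak231 (Start k)} λ {π} → avoids-132⇔ (start? k) sparse-starts {π}))
    peak≐P132 ,
  ≃#-via (∩-dec λ π → triples? λ a b c → start? k b →-dec (_ Fin.<? _))
    (∩-invariant (ordered-invariant (Start k)) (valley312-invariant (Start k)))
    (≐-sym (𝒟[]≐ p213 {Valley312 (Start k)} λ {π} → avoids-213⇔ (start? k) sparse-starts {π}))
    valley≐P213
  where
  open StandardBlocks k m s 2≤k 1≤s s≤k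
  open BlockPosets m s h s≤k using (peak≐P132; valley≐P213)
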